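{- Let $a,b,c$ be nonnegative integers with $c\ge1$, and let $x_1,\ldots,x_{a+c},y_1,\ldots,y_{b+c}$ be indeterminates. Then, as rational functions, \[ \sum_{\Gamma=(\gamma_1,\ldots,\gamma_c)}\ \prod_{(i,j)\in\Gamma}\frac{1}{x_i-y_j}=\sum_{\Theta=(\theta_1,\ldots,\theta_c)}\ \prod_{(i,j)\in\Theta}\frac{1}{x_i-y_j}, \] where the left sum is over $c$-tuples of pairwise non-intersecting lattice paths in the grid $\{1,\ldots,a+c\}\times\{1,\ldots,b+c\}$ with $\gamma_p$ going from cell $(a+p,1)$ to cell $(p,b+c)$ using steps $(i,j)\to(i-1,j)$ and $(i,j)\to(i,j+1)$, and the right sum is over $c$-tuples of pairwise non-intersecting lattice paths with $\theta_p$ going from cell $(p,1)$ to cell $(a+p,b+c)$ using steps $(i,j)\to(i+1,j)$ and $(i,j)\to(i,j+1)$.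
   Context: Cells $(i,j)$ index row $i$ and column $j$ of the $(a+c)\times(b+c)$ grid. A lattice path is identified with its set of cells; paths are non-intersecting if they share no cell. The product over $(i,j)\in\Gamma$ is over all cells lying on some path of the tuple. -}

module Defs where

open import Data.Nat using (ℕ; zero; suc; _+_; _∸_; _≡ᵇ_)
open import Data.Bool using (Bool; true; false; _∧_; _∨_; not)
open import Data.List using (List; []; _∷_; _++_; map; concatMap; filter; foldr; concat)
open import Data.Bool.ListAction using (any; all)
open import Data.Product using (_×_; _,_)
open import Relation.Nullary.Decidable using (Dec)
open import Data.Bool using (T)
open import Data.Bool.Properties using (T?)
open import Algebra.Bundles using (CommutativeRing)
open import Level using (Level)

-- A cell (i , j) : row i, column j (1-based, as in the paper).
Cell : Set
Cell = ℕ × ℕ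

-- All step words of length n with exactly k vertical steps (true = vertical, false = horizontal).
words : ℕ → ℕ → List (List Bool)
words zero zero = [] ∷ []
words zero (suc k) = []
words (suc n) zero = map (false ∷_) (words n zero)
words (suc n) (suc k) = map (false ∷_) (words n (suc k)) ++ map (true ∷_) (words n k)

cellsUp : ℕ → ℕ → List Bool → List Cell
cellsUp i j [] = (i , j) ∷ []
cellsUp i j (true ∷ s) = (i , j) ∷ cellsUp (i ∸ 1) j s
cellsUp i j (false ∷ s) = (i , j) ∷ cellsUp i (suc j) s

cellsDown : ℕ → ℕ → List Bool → List Cell
cellsDown i j [] = (i , j) ∷ []
cellsDown i j (true ∷ s) = (i , j) ∷ cellsDown (suc i) j s
cellsDown i j (false ∷ s) = (i , j) ∷ cellsDown i (suc j) s

-- γ_p : from (a+p, 1) to (p, b+c) : a vertical (up) steps and b+c-1 horizontal steps.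
pathsΓ : ℕ → ℕ → ℕ → ℕ → List (List Cell)
pathsΓ a b c p = map (cellsUp (a + p) 1) (words (a + (b + c ∸ 1)) a)

-- θ_p : from (p, 1) to (a+p, b+c) : a vertical (down) steps and b+c-1 horizontal steps.
pathsΘ : ℕ → ℕ → ℕ → ℕ → List (List Cell)
pathsΘ a b c p = map (cellsDown p 1) (words (a + (b + c ∸ 1)) a)

tuples : {A : Set} → (ℕ → List A) → ℕ → List (List A)
tuples f zero = [] ∷ []
tuples f (suc n) = concatMap (λ t → map (λ q → t ++ (q ∷ [])) (f (suc n))) (tuples f n)

cellEq : Cell → Cell → Bool
cellEq (i , j) (k , l) = (i ≡ᵇ k) ∧ (j ≡ᵇ l)

disjointᵇ : List Cell → List Cell → Bool
disjointᵇ P Q = all (λ u → not (any (cellEq u) Q)) P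

pairwiseDisjointᵇ : List (List Cell) → Bool
pairwiseDisjointᵇ [] = true
pairwiseDisjointᵇ (P ∷ Ps) = all (disjointᵇ P) Ps ∧ pairwiseDisjointᵇ Ps

nonIntersecting : (ℕ → List (List Cell)) → ℕ → List (List (List Cell))
nonIntersecting f c = filter (λ t → T? (pairwiseDisjointᵇ t)) (tuples f c)

module _ {ℓ₁ ℓ₂ : Level} (R : CommutativeRing ℓ₁ ℓ₂) where
  open CommutativeRing R using (Carrier; 1#; 0#) renaming (_+_ to _⊕_; _*_ to _⊛_)

  -- product over the cells of the tuple of the weight w (i , j) = 1/(x_i - y_j)
  weight : (ℕ → ℕ → Carrier) → List (List Cell) → Carrier
  weight w t = foldr (λ { (i , j) r → w i j ⊛ r }) 1# (concat t)

  sumOver : (ℕ → ℕ → Carrier) → List (List (List Cell)) → Carrier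
  sumOver w ts = foldr (λ t r → weight w t ⊕ r) 0# ts

  LHS : ℕ → ℕ → ℕ → (ℕ → ℕ → Carrier) → Carrier
  LHS a b c w = sumOver w (nonIntersecting (pathsΓ a b c) c)

  RHS : ℕ → ℕ → ℕ → (ℕ → ℕ → Carrier) → Carrier
  RHS a b c w = sumOver w (nonIntersecting (pathsΘ a b c) c)

{-# OPTIONS --safe #-}
module Submission where

-- Turning the grid upside down turns the paths γ into paths of the same kind as the
-- paths θ, so the theorem says that the sum over Θ is invariant under reversing the order
-- of x_1, …, x_{a+c}; it is in fact symmetric in these variables.  Encode the rows occupied
-- by the paths between two consecutive columns as a state, so that the sum is a matrix
-- element of a product of column transfer operators.  The operator that adds to the state
-- with row i + 1 occupied and row i free the multiple x_i − x_{i+1} of the state with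
-- these two rows exchanged intertwines the column operators for x and for x with x_i and
-- x_{i+1} exchanged (Yang–Baxter), and it fixes both the initial state {1, …, c} and the
-- final state {a + 1, …, a + c}.

open import Defs
open import Algebra.Bundles using (CommutativeRing)
open import Data.Bool using (Bool; true; false; _∧_; _∨_; not; if_then_else_)
open import Data.Bool.ListAction using (any; all)
open import Data.Bool.Properties using (T?; ∧-comm; ∧-assoc; ∧-identityʳ; ∧-zeroʳ)
open import Data.Empty using (⊥-elim)
open import Data.List using (List; []; _∷_; _++_; [_]; map; concatMap; filter; foldr)
open import Data.List.Properties using (++-assoc; ++-identityʳ; map-++; map-∘; map-cong)
open import Data.List.Relation.Binary.Permutation.Propositional as Perm using (_↭_; prep; swap; ↭-trans)
open import Data.List.Relation.Binary.Permutation.Propositional.Properties using (shift)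
open import Data.List.Relation.Unary.All as All using (All; []; _∷_)
open import Data.List.Relation.Unary.All.Properties using (++⁺; map⁺)
open import Data.Nat using (ℕ; zero; suc; _+_; _∸_; _≤_; _<_; _≡ᵇ_; z≤n; s≤s)
open import Data.Nat.Properties using (≤-refl; ≤-trans; ≤-reflexive; ≤-<-trans; <⇒≤; <⇒≢; >⇒≢; m≤n⇒m≤1+n; m<n⇒m<1+n; m≤m+n; m∸n≤m; m≢1+m+n; 1+n≢0; suc-injective; +-identityʳ; +-suc; +-comm)
open import Data.Product using (_×_; _,_)
open import Data.Vec using (Vec; []; _∷_; iterate)
open import Data.Vec.Relation.Unary.All as AllV using ([]; _∷_) renaming (All to AllV)
open import Data.Vec.Relation.Unary.AllPairs using ([]; _∷_)
open import Data.Vec.Relation.Unary.Unique.Propositional using (Unique)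
open import Function using (_∘_)
open import Level using (Level)
open import Relation.Binary.Construct.Closure.ReflexiveTransitive using (Star; ε; _◅_; _◅◅_; gmap)
open import Relation.Binary.PropositionalEquality as ≡ using (_≡_; _≢_; _≗_; cong; cong₂; subst)

-- Disjointness of paths as a Boolean test.

Path : Set
Path = List Cell

≡ᵇ-refl : ∀ n → (n ≡ᵇ n) ≡ true
≡ᵇ-refl zero    = ≡.refl
≡ᵇ-refl (suc n) = ≡ᵇ-refl n

≢⇒≡ᵇ-false : ∀ {m n} → m ≢ n → (m ≡ᵇ n) ≡ false
≢⇒≡ᵇ-false {zero}  {zero}  m≢n = ⊥-elim (m≢n ≡.refl)
≢⇒≡ᵇ-false {zero}  {suc n} m≢n = ≡.refl
≢⇒≡ᵇ-false {suc m} {zero}  m≢n = ≡.refl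
≢⇒≡ᵇ-false {suc m} {suc n} m≢n = ≢⇒≡ᵇ-false (m≢n ∘ cong suc)

≡ᵇ-sym : ∀ m n → (m ≡ᵇ n) ≡ (n ≡ᵇ m)
≡ᵇ-sym zero    zero    = ≡.refl
≡ᵇ-sym zero    (suc n) = ≡.refl
≡ᵇ-sym (suc m) zero    = ≡.refl
≡ᵇ-sym (suc m) (suc n) = ≡ᵇ-sym m n

∧-interchange : ∀ p q r s → (p ∧ q) ∧ (r ∧ s) ≡ (p ∧ r) ∧ (q ∧ s)
∧-interchange true  true  r s = ≡.refl
∧-interchange true  false r s = ≡.sym (∧-zeroʳ r)
∧-interchange false q     r s = ≡.refl

all-∷ʳ : ∀ {A : Set} (p : A → Bool) xs x → all p (xs ++ [ x ]) ≡ all p xs ∧ p x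
all-∷ʳ p []       x = ∧-identityʳ (p x)
all-∷ʳ p (y ∷ xs) x = ≡.trans (cong (p y ∧_) (all-∷ʳ p xs x)) (≡.sym (∧-assoc (p y) (all p xs) (p x)))

cellEq-refl : ∀ u → cellEq u u ≡ true
cellEq-refl (i , j) = cong₂ _∧_ (≡ᵇ-refl i) (≡ᵇ-refl j)

cellEq-sym : ∀ u v → cellEq u v ≡ cellEq v u
cellEq-sym (i , j) (k , l) = cong₂ _∧_ (≡ᵇ-sym i k) (≡ᵇ-sym j l)

disjointᵇ-[] : ∀ P → disjointᵇ P [] ≡ true
disjointᵇ-[] []      = ≡.refl
disjointᵇ-[] (u ∷ P) = disjointᵇ-[] P

-- `disjointᵇ` recurses on its first argument; this recursion on the second one yields its symmetry.
disjointᵇ-∷ʳ : ∀ P v Q → disjointᵇ P (v ∷ Q) ≡ not (any (cellEq v) P) ∧ disjointᵇ P Q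
disjointᵇ-∷ʳ []      v Q = ≡.refl
disjointᵇ-∷ʳ (u ∷ P) v Q rewrite cellEq-sym u v | disjointᵇ-∷ʳ P v Q =
  regroup (cellEq v u) (any (cellEq u) Q) (any (cellEq v) P) (disjointᵇ P Q)
  where
  regroup : ∀ p q r s → not (p ∨ q) ∧ (not r ∧ s) ≡ not (p ∨ r) ∧ (not q ∧ s)
  regroup true  q     r     s = ≡.refl
  regroup false true  true  s = ≡.refl
  regroup false true  false s = ≡.refl
  regroup false false true  s = ≡.refl
  regroup false false false s = ≡.refl

disjointᵇ-sym : ∀ P Q → disjointᵇ P Q ≡ disjointᵇ Q P
disjointᵇ-sym P []      = disjointᵇ-[] P
disjointᵇ-sym P (v ∷ Q) = ≡.trans (disjointᵇ-∷ʳ P v Q) (cong (not (any (cellEq v) P) ∧_) (disjointᵇ-sym P Q))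

disjointᵇ-common-head : ∀ u P Q → disjointᵇ (u ∷ P) (u ∷ Q) ≡ false
disjointᵇ-common-head u P Q rewrite cellEq-refl u = ≡.refl

pairwiseDisjointᵇ-∷ʳ : ∀ t Q →
  pairwiseDisjointᵇ (t ++ [ Q ]) ≡ pairwiseDisjointᵇ t ∧ all (λ P → disjointᵇ P Q) t
pairwiseDisjointᵇ-∷ʳ []      Q = ≡.refl
pairwiseDisjointᵇ-∷ʳ (P ∷ t) Q
  rewrite all-∷ʳ (disjointᵇ P) t Q | pairwiseDisjointᵇ-∷ʳ t Q =
  ∧-interchange (all (disjointᵇ P) t) (disjointᵇ P Q) (pairwiseDisjointᵇ t) _

-- States and families of paths along ordered rows.

Free : Cell → Path → Set
Free u Q = any (cellEq u) Q ≡ false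

-- State n c encodes a c-element subset of n rows, listed from the first row on.
data State : ℕ → ℕ → Set where
  []  : State 0 0
  out : ∀ {n c} → State n c → State (suc n) c
  inn : ∀ {n c} → State n c → State (suc n) (suc c)

State⇒≤ : ∀ {n c} → State n c → c ≤ n
State⇒≤ []      = z≤n
State⇒≤ (out S) = m≤n⇒m≤1+n (State⇒≤ S)
State⇒≤ (inn S) = s≤s (State⇒≤ S)

-- Along increasing rows these are the entry rows of the paths θ, along decreasing rows those of the
-- paths γ, so one initial state serves both sums.
topRows : ∀ c a → State (c + a) c
topRows zero    zero    = []
topRows zero    (suc a) = out (topRows zero a)
topRows (suc c) a       = inn (topRows c a)

-- The paths through h columns starting in column j that enter at the first of the
-- rows rs, run along the rows in the order of rs, and leave at the row with m rows after it.
family : ∀ {n} → Vec ℕ n → ℕ → ℕ → ℕ → List Path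
family []               m j h       = []
family {suc n} (r ∷ rs) m j zero    = if n ≡ᵇ m then [ [] ] else []
family (r ∷ rs)         m j (suc h) = map ((r , j) ∷_) (family (r ∷ rs) m (suc j) h ++ family rs m j (suc h))

-- The paths of a non-intersecting tuple keep their order and leave at the last c rows,
-- so the target of a path is determined by the number of paths after it.
families : ∀ {n c} → Vec ℕ n → State n c → ℕ → ℕ → List (List Path)
families []       []              j h = []
families (r ∷ rs) (out S)         j h = families rs S j h
families (r ∷ rs) (inn {c = c} S) j h = family (r ∷ rs) c j h ∷ families rs S j h

family-free : ∀ {n} u (rs : Vec ℕ n) m j h →
  (∀ l → j ≤ l → AllV (λ r → cellEq u (r , l) ≡ false) rs) → All (Free u) (family rs m j h)
family-free u [] m j h u≢ = []
family-free {suc n} u (r ∷ rs) m j zero u≢ with n ≡ᵇ m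
... | true  = ≡.refl ∷ []
... | false = []
family-free u (r ∷ rs) m j (suc h) u≢ =
  map⁺ (All.map (λ free → cong₂ _∨_ (AllV.head (u≢ j ≤-refl)) free)
    (++⁺ (family-free u (r ∷ rs) m (suc j) h (λ l j<l → u≢ l (<⇒≤ j<l)))
         (family-free u rs m j (suc h) (λ l j≤l → AllV.tail (u≢ l j≤l)))))

family-free-later : ∀ {n} r {j} (rs : Vec ℕ n) m h → All (Free (r , j)) (family rs m (suc j) h)
family-free-later r {j} rs m h = family-free (r , j) rs m (suc j) h (λ l j<l → AllV.universal (λ s →
  ≡.trans (cong ((r ≡ᵇ s) ∧_) (≢⇒≡ᵇ-false (<⇒≢ j<l))) (∧-zeroʳ (r ≡ᵇ s))) rs)

family-free-row : ∀ {n} {r j} {rs : Vec ℕ n} → AllV (r ≢_) rs → ∀ m l h → All (Free (r , j)) (family rs m l h)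
family-free-row {r = r} {j} r∉rs m l h = family-free (r , j) _ m l h (λ l′ _ →
  AllV.map (λ r≢s → cong (_∧ (j ≡ᵇ l′)) (≢⇒≡ᵇ-false r≢s)) r∉rs)

families-free-row : ∀ {n c} {r j} {rs : Vec ℕ n} → AllV (r ≢_) rs → (S : State n c) → ∀ l h →
  All (All (Free (r , j))) (families rs S l h)
families-free-row []           []      l h = []
families-free-row {j = j} (r≢ ∷ r∉rs) (out S) l h = families-free-row {j = j} r∉rs S l h
families-free-row {j = j} (r≢ ∷ r∉rs) (inn S) l h =
  family-free-row {j = j} (r≢ ∷ r∉rs) _ l h ∷ families-free-row {j = j} r∉rs S l h

-- The target would lie before the first row of `rs`, and paths never run back.
family-short : ∀ {n m} (rs : Vec ℕ n) → n ≤ m → ∀ j h → family rs m j h ≡ []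
family-short []       n≤m j h = ≡.refl
family-short {suc n} {m} (r ∷ rs) n<m j zero    rewrite ≢⇒≡ᵇ-false {n} {m} (<⇒≢ n<m) = ≡.refl
family-short (r ∷ rs) n<m j (suc h)
  rewrite family-short (r ∷ rs) n<m (suc j) h | family-short rs (<⇒≤ n<m) j (suc h) = ≡.refl

-- Families along consecutive rows as step words.

words-short : ∀ {n k} → n < k → words n k ≡ []
words-short {zero}  {suc k} _         = ≡.refl
words-short {suc n} {suc k} (s≤s n<k) rewrite words-short (m<n⇒m<1+n n<k) | words-short n<k = ≡.refl

-- The vertical step is a parameter, so that one argument covers both path systems.
walk : (ℕ → ℕ) → ℕ → ℕ → List Bool → Path
walk f i j []          = [ (i , j) ]
walk f i j (true ∷ s)  = (i , j) ∷ walk f (f i) j s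
walk f i j (false ∷ s) = (i , j) ∷ walk f i (suc j) s

cellsDown≗walk : ∀ i j → cellsDown i j ≗ walk suc i j
cellsDown≗walk i j []          = ≡.refl
cellsDown≗walk i j (true ∷ s)  = cong (_ ∷_) (cellsDown≗walk (suc i) j s)
cellsDown≗walk i j (false ∷ s) = cong (_ ∷_) (cellsDown≗walk i (suc j) s)

cellsUp≗walk : ∀ i j → cellsUp i j ≗ walk (_∸ 1) i j
cellsUp≗walk i j []          = ≡.refl
cellsUp≗walk i j (true ∷ s)  = cong (_ ∷_) (cellsUp≗walk (i ∸ 1) j s)
cellsUp≗walk i j (false ∷ s) = cong (_ ∷_) (cellsUp≗walk i (suc j) s)

map-walk-∷ : ∀ f i j i′ j′ b → (∀ s → walk f i j (b ∷ s) ≡ (i , j) ∷ walk f i′ j′ s) → ∀ ss →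
  map (walk f i j) (map (b ∷_) ss) ≡ map ((i , j) ∷_) (map (walk f i′ j′) ss)
map-walk-∷ f i j i′ j′ b step ss = ≡.trans (≡.sym (map-∘ ss)) (≡.trans (map-cong step ss) (map-∘ ss))

-- Leaving the last column uses up a column in `family` but is no letter of a word, hence `suc h`
-- columns against `h` horizontal steps. The `k` vertical steps lead from the row with `m + k` rows
-- after it to the row with `m`.
family-iterate : ∀ f i m k j h {n} → n ≡ m + k →
  family (iterate f i (suc n)) m j (suc h) ≡ map (walk f i j) (words (k + h) k)
family-iterate f i m zero j zero {n} n≡m
  rewrite ≡.trans n≡m (+-identityʳ m) | ≡ᵇ-refl m | family-short (iterate f (f i) m) ≤-refl j 1 = ≡.refl
-- The path already runs in its target row, so the vertical branch is empty.
family-iterate f i m zero j (suc h) {n} n≡m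
  rewrite family-short (iterate f (f i) n) (≤-reflexive (≡.trans n≡m (+-identityʳ m))) j (2 + h)
        | ++-identityʳ (family (iterate f i (suc n)) m (suc j) (suc h))
        | family-iterate f i m zero (suc j) h n≡m =
  ≡.sym (map-walk-∷ f i j i (suc j) false (λ _ → ≡.refl) (words h zero))
family-iterate f i m (suc k) j zero {zero} n≡m = ⊥-elim (1+n≢0 (≡.trans (≡.sym (+-suc m k)) (≡.sym n≡m)))
family-iterate f i m (suc k) j zero {suc n} n≡m
  rewrite ≢⇒≡ᵇ-false {suc n} {m} (λ n≡m′ → m≢1+m+n m (≡.trans (≡.sym n≡m′) (≡.trans n≡m (+-suc m k))))
        | words-short {k + 0} {suc k} (s≤s (≤-reflexive (+-identityʳ k)))
        | family-iterate f (f i) m k j zero (suc-injective (≡.trans n≡m (+-suc m k))) =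
  ≡.sym (map-walk-∷ f i j (f i) j true (λ _ → ≡.refl) (words (k + 0) k))
family-iterate f i m (suc k) j (suc h) {zero} n≡m = ⊥-elim (1+n≢0 (≡.trans (≡.sym (+-suc m k)) (≡.sym n≡m)))
family-iterate f i m (suc k) j (suc h) {suc n} n≡m
  rewrite family-iterate f i m (suc k) (suc j) h n≡m
        | family-iterate f (f i) m k j (suc h) (suc-injective (≡.trans n≡m (+-suc m k)))
        | map-++ (walk f i j) (map (false ∷_) (words (k + suc h) (suc k))) (map (true ∷_) (words (k + suc h) k))
        | map-walk-∷ f i j i (suc j) false (λ _ → ≡.refl) (words (k + suc h) (suc k))
        | map-walk-∷ f i j (f i) j true (λ _ → ≡.refl) (words (k + suc h) k)
        | +-suc k h =
  map-++ ((i , j) ∷_) (map (walk f i (suc j)) (words (suc k + h) (suc k))) (map (walk f (f i) j) (words (suc (k + h)) k))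

-- Reversing the row order by adjacent exchanges.

data AdjacentSwap : ∀ {n} → ℕ → ℕ → ℕ → Vec ℕ n → Vec ℕ n → Set where
  here  : ∀ {n r s} {rs : Vec ℕ n} → AdjacentSwap zero r s (r ∷ s ∷ rs) (s ∷ r ∷ rs)
  there : ∀ {n m r s q} {rs rs′ : Vec ℕ n} →
    AdjacentSwap m r s rs rs′ → AdjacentSwap (suc m) r s (q ∷ rs) (q ∷ rs′)

module _ (N : ℕ) where

  InRange : ℕ → Set
  InRange r = 1 ≤ r × r ≤ N

  -- Both rows must lie in the grid, since the weights are known to be inverses only there.
  data Rearrange {n} (rs rs′ : Vec ℕ n) : Set where
    step : ∀ {m r s} → InRange r → InRange s → AdjacentSwap m r s rs rs′ → Rearrange rs rs′

  rearrange-∷ : ∀ {n} q {rs rs′ : Vec ℕ n} → Star Rearrange rs rs′ → Star Rearrange (q ∷ rs) (q ∷ rs′)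
  rearrange-∷ q = gmap (q ∷_) (λ { (step r∈ s∈ sw) → step r∈ s∈ (there sw) })

  -- The last row first passes all rows after `i`; one more exchange takes it past `i`.
  last-to-front : ∀ i n → 1 ≤ i → i + n ≤ N → Star Rearrange (iterate suc i (suc n)) (i + n ∷ iterate suc i n)
  last-to-front i zero    1≤i i≤N rewrite +-identityʳ i = ε
  last-to-front i (suc n) 1≤i i≤N rewrite +-suc i n =
    rearrange-∷ i (last-to-front (suc i) n (s≤s z≤n) i≤N)
      ◅◅ step (1≤i , ≤-trans (m≤m+n i n) (<⇒≤ i≤N)) (s≤s z≤n , i≤N) here ◅ ε

  increasing⇝decreasing : ∀ n → n ≤ N → Star Rearrange (iterate suc 1 n) (iterate (_∸ 1) n n)
  increasing⇝decreasing zero    _   = ε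
  increasing⇝decreasing (suc n) n<N =
    last-to-front 1 n (s≤s z≤n) n<N ◅◅ rearrange-∷ (suc n) (increasing⇝decreasing n (<⇒≤ n<N))

increasing-bounds : ∀ {r i} n → r < i → AllV (r ≢_) (iterate suc i n)
increasing-bounds zero    r<i = []
increasing-bounds (suc n) r<i = <⇒≢ r<i ∷ increasing-bounds n (m<n⇒m<1+n r<i)

increasing-unique : ∀ i n → Unique (iterate suc i n)
increasing-unique i zero    = []
increasing-unique i (suc n) = increasing-bounds n ≤-refl ∷ increasing-unique (suc i) n

decreasing-bounds : ∀ {r i} n → i < r → AllV (r ≢_) (iterate (_∸ 1) i n)
decreasing-bounds zero    i<r = []
decreasing-bounds (suc n) i<r = >⇒≢ i<r ∷ decreasing-bounds n (≤-<-trans (m∸n≤m _ 1) i<r)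

-- The length equals the starting row, so the list stops at 1 before truncated subtraction could
-- repeat a value.
decreasing-unique : ∀ n → Unique (iterate (_∸ 1) n n)
decreasing-unique zero    = []
decreasing-unique (suc n) = decreasing-bounds n ≤-refl ∷ decreasing-unique n

-- The two path systems as lists of families.

module _ {A : Set} (f : ℕ → A) where

  segment : ℕ → ℕ → List A
  segment i zero    = []
  segment i (suc n) = f i ∷ segment (suc i) n

  -- The accumulator follows `tuples`, whose last coordinate is split off first.
  prepend : ℕ → List A → List A
  prepend zero    xs = xs
  prepend (suc n) xs = prepend n (f (suc n) ∷ xs)

  -- Along decreasing rows the path γ with the largest index enters first.
  descending : ℕ → List A
  descending zero    = []
  descending (suc n) = f (suc n) ∷ descending n

  prepend-segment : ∀ n m → prepend n (segment (suc n) m) ≡ segment 1 (n + m)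
  prepend-segment zero    m = ≡.refl
  prepend-segment (suc n) m = ≡.trans (prepend-segment n (suc m)) (cong (segment 1) (+-suc n m))

  prepend-↭ : ∀ n xs → prepend n xs ↭ descending n ++ xs
  prepend-↭ zero    xs = Perm.refl
  prepend-↭ (suc n) xs = ↭-trans (prepend-↭ n (f (suc n) ∷ xs)) (shift (f (suc n)) (descending n) xs)

-- The first path has `c′ + a` rows and `c′` paths after it, so it makes exactly `a` vertical steps.
families-increasing : ∀ a b c i h → suc h ≡ b + c → ∀ c′ →
  families (iterate suc i (c′ + a)) (topRows c′ a) 1 (b + c) ≡ segment (pathsΘ a b c) i c′
families-increasing a b c i h eq zero    = no-paths a i
  where
  no-paths : ∀ a i → families (iterate suc i a) (topRows 0 a) 1 (b + c) ≡ []
  no-paths zero    i = ≡.refl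
  no-paths (suc a) i = no-paths a (suc i)
families-increasing a b c i h eq (suc c′) = cong₂ _∷_ head (families-increasing a b c (suc i) h eq c′)
  where
  head : family (iterate suc i (suc (c′ + a))) c′ 1 (b + c) ≡ pathsΘ a b c i
  head rewrite ≡.sym eq = ≡.trans (family-iterate suc i c′ a 1 h ≡.refl)
    (≡.sym (map-cong (cellsDown≗walk i 1) (words (a + h) a)))

families-decreasing : ∀ a b c h → suc h ≡ b + c → ∀ c′ →
  families (iterate (_∸ 1) (c′ + a) (c′ + a)) (topRows c′ a) 1 (b + c) ≡ descending (pathsΓ a b c) c′
families-decreasing a b c h eq zero = no-paths a a
  where
  no-paths : ∀ a i → families (iterate (_∸ 1) i a) (topRows 0 a) 1 (b + c) ≡ []
  no-paths zero    i = ≡.refl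
  no-paths (suc a) i = no-paths a (i ∸ 1)
families-decreasing a b c h eq (suc c′) = cong₂ _∷_ head (families-decreasing a b c h eq c′)
  where
  head : family (iterate (_∸ 1) (suc (c′ + a)) (suc (c′ + a))) c′ 1 (b + c) ≡ pathsΓ a b c (suc c′)
  head rewrite ≡.sym eq | +-comm a (suc c′) = ≡.trans (family-iterate (_∸ 1) (suc (c′ + a)) c′ a 1 h ≡.refl)
    (≡.sym (map-cong (cellsUp≗walk (suc (c′ + a)) 1) (words (a + h) a)))

-- Finite sums with Boolean guards.

module _ {ℓ₁ ℓ₂ : Level} (R : CommutativeRing ℓ₁ ℓ₂) (w : ℕ → ℕ → CommutativeRing.Carrier R) where
  open CommutativeRing R using (Carrier; _≈_; 0#; 1#; refl; sym; trans; reflexive; setoid; commutativeSemiring; zeroˡ; zeroʳ; distribˡ)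
    renaming (_+_ to _⊕_; _*_ to _⊛_; +-cong to ⊕-cong; *-cong to ⊛-cong; +-congˡ to ⊕-congˡ; +-congʳ to ⊕-congʳ; *-congˡ to ⊛-congˡ; +-identityˡ to ⊕-identityˡ; +-identityʳ to ⊕-identityʳ; +-assoc to ⊕-assoc; *-assoc to ⊛-assoc; *-congʳ to ⊛-congʳ; *-identityˡ to ⊛-identityˡ; *-identityʳ to ⊛-identityʳ)
  open import Algebra.Solver.Ring.NaturalCoefficients.Default commutativeSemiring using (solve; _:+_; _:*_; _:=_; con)
  open import Relation.Binary.Reasoning.Setoid setoid

  ∑ : {A : Set} → List A → (A → Carrier) → Carrier
  ∑ xs f = foldr (λ x r → f x ⊕ r) 0# xs

  ⟦_⟧_ : Bool → Carrier → Carrier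
  ⟦ b ⟧ x = if b then x else 0#

  ⟦⟧-cong : ∀ {b b′ x x′} → b ≡ b′ → x ≈ x′ → ⟦ b ⟧ x ≈ ⟦ b′ ⟧ x′
  ⟦⟧-cong {true}  ≡.refl x≈x′ = x≈x′
  ⟦⟧-cong {false} ≡.refl x≈x′ = refl

  ∑-cong-All : ∀ {A : Set} {f g : A → Carrier} {xs} → All (λ x → f x ≈ g x) xs → ∑ xs f ≈ ∑ xs g
  ∑-cong-All []         = refl
  ∑-cong-All (eq ∷ eqs) = ⊕-cong eq (∑-cong-All eqs)

  ∑-cong : ∀ {A : Set} {f g : A → Carrier} xs → (∀ x → f x ≈ g x) → ∑ xs f ≈ ∑ xs g
  ∑-cong xs eq = ∑-cong-All (All.universal eq xs)

  ∑-zero : ∀ {A : Set} {f : A → Carrier} xs → (∀ x → f x ≈ 0#) → ∑ xs f ≈ 0#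
  ∑-zero []       eq = refl
  ∑-zero (x ∷ xs) eq = trans (⊕-cong (eq x) (∑-zero xs eq)) (⊕-identityˡ 0#)

  ∑-++ : ∀ {A : Set} {f : A → Carrier} xs ys → ∑ (xs ++ ys) f ≈ ∑ xs f ⊕ ∑ ys f
  ∑-++ []       ys = sym (⊕-identityˡ _)
  ∑-++ (x ∷ xs) ys = trans (⊕-congˡ (∑-++ xs ys)) (sym (⊕-assoc _ _ _))

  ∑-map : ∀ {A B : Set} {f : B → Carrier} (g : A → B) xs → ∑ (map g xs) f ≈ ∑ xs (f ∘ g)
  ∑-map g []       = refl
  ∑-map g (x ∷ xs) = ⊕-congˡ (∑-map g xs)

  ∑-concatMap : ∀ {A B : Set} {f : B → Carrier} (g : A → List B) xs → ∑ (concatMap g xs) f ≈ ∑ xs (λ x → ∑ (g x) f)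
  ∑-concatMap g []       = refl
  ∑-concatMap g (x ∷ xs) = trans (∑-++ (g x) (concatMap g xs)) (⊕-congˡ (∑-concatMap g xs))

  ∑-filter : ∀ {A : Set} {f : A → Carrier} (p : A → Bool) xs → ∑ (filter (λ x → T? (p x)) xs) f ≈ ∑ xs (λ x → ⟦ p x ⟧ f x)
  ∑-filter p []       = refl
  ∑-filter p (x ∷ xs) with p x
  ... | true  = ⊕-congˡ (∑-filter p xs)
  ... | false = trans (∑-filter p xs) (sym (⊕-identityˡ _))

  ∑-⊛ : ∀ {A : Set} {f : A → Carrier} a xs → a ⊛ ∑ xs f ≈ ∑ xs (λ x → a ⊛ f x)
  ∑-⊛ a []       = zeroʳ a
  ∑-⊛ a (x ∷ xs) = trans (distribˡ _ _ _) (⊕-congˡ (∑-⊛ a xs))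

  ∑-⟦⟧ : ∀ {A : Set} {f : A → Carrier} b xs → ⟦ b ⟧ ∑ xs f ≈ ∑ xs (λ x → ⟦ b ⟧ f x)
  ∑-⟦⟧ true  xs = refl
  ∑-⟦⟧ false xs = sym (∑-zero xs (λ _ → refl))

  ∑-⊕ : ∀ {A : Set} {f g : A → Carrier} xs → ∑ xs (λ x → f x ⊕ g x) ≈ ∑ xs f ⊕ ∑ xs g
  ∑-⊕ []       = sym (⊕-identityˡ 0#)
  ∑-⊕ (x ∷ xs) = trans (⊕-congˡ (∑-⊕ xs))
    (solve 4 (λ p q r s → (p :+ q) :+ (r :+ s) := (p :+ r) :+ (q :+ s)) refl _ _ _ _)

  ∑-comm : ∀ {A B : Set} {f : A → B → Carrier} xs ys → ∑ xs (λ x → ∑ ys (f x)) ≈ ∑ ys (λ y → ∑ xs (λ x → f x y))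
  ∑-comm []       ys = sym (∑-zero ys (λ _ → refl))
  ∑-comm (x ∷ xs) ys = trans (⊕-congˡ (∑-comm xs ys)) (sym (∑-⊕ ys))

  -- Weighted sums over disjoint choices of paths.

  pathWeight : Path → Carrier
  pathWeight []            = 1#
  pathWeight ((i , j) ∷ P) = w i j ⊛ pathWeight P

  -- Sum over the choices of one path from each family such that every chosen path
  -- satisfies ok and the chosen paths are pairwise disjoint.
  pathSum : (Path → Bool) → List (List Path) → Carrier
  pathSum ok []       = 1#
  pathSum ok (F ∷ Fs) = ∑ F (λ P → ⟦ ok P ⟧ (pathWeight P ⊛ pathSum (λ Q → ok Q ∧ disjointᵇ P Q) Fs))

  -- Agreement on the listed paths suffices; this allows a cell that none of them contains to be
  -- dropped from the test.
  pathSum-cong : ∀ {ok ok′} {Fs} → All (All (λ Q → ok Q ≡ ok′ Q)) Fs → pathSum ok Fs ≈ pathSum ok′ Fs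
  pathSum-cong []         = refl
  pathSum-cong (eq ∷ eqs) = ∑-cong-All (All.map
    (λ {P} e → ⟦⟧-cong e (⊛-congˡ (pathSum-cong (All.map (All.map (λ {Q} → cong (_∧ disjointᵇ P Q))) eqs)))) eq)

  pathSum-cong-≗ : ∀ {ok ok′} Fs → ok ≗ ok′ → pathSum ok Fs ≈ pathSum ok′ Fs
  pathSum-cong-≗ Fs eq = pathSum-cong (All.universal (All.universal eq) Fs)

  -- Disjointness is symmetric and the ring commutative, so the choices of `P` and `Q` can be made
  -- in either order.
  pathSum-swap : ∀ ok F G Fs → pathSum ok (F ∷ G ∷ Fs) ≈ pathSum ok (G ∷ F ∷ Fs)
  pathSum-swap ok F G Fs = begin
    ∑ F (λ P → ⟦ ok P ⟧ (pathWeight P ⊛ ∑ G (λ Q → inner P Q)))   ≈⟨ ∑-cong F (λ P → distribute (ok P) (pathWeight P) G) ⟩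
    ∑ F (λ P → ∑ G (λ Q → ⟦ ok P ⟧ (pathWeight P ⊛ inner P Q)))   ≈⟨ ∑-comm F G ⟩
    ∑ G (λ Q → ∑ F (λ P → ⟦ ok P ⟧ (pathWeight P ⊛ inner P Q)))   ≈⟨ ∑-cong G (λ Q → ∑-cong F (λ P → exchanged P Q)) ⟩
    ∑ G (λ Q → ∑ F (λ P → ⟦ ok Q ⟧ (pathWeight Q ⊛ inner Q P)))   ≈⟨ ∑-cong G (λ Q → distribute (ok Q) (pathWeight Q) F) ⟨
    ∑ G (λ Q → ⟦ ok Q ⟧ (pathWeight Q ⊛ ∑ F (λ P → inner Q P)))   ∎
    where
    both : Path → Path → Path → Bool
    both P Q Z = (ok Z ∧ disjointᵇ P Z) ∧ disjointᵇ Q Z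

    inner : Path → Path → Carrier
    inner P Q = ⟦ ok Q ∧ disjointᵇ P Q ⟧ (pathWeight Q ⊛ pathSum (both P Q) Fs)

    distribute : ∀ {A : Set} {f : A → Carrier} b x xs → ⟦ b ⟧ (x ⊛ ∑ xs f) ≈ ∑ xs (λ z → ⟦ b ⟧ (x ⊛ f z))
    distribute b x xs = trans (⟦⟧-cong {b} ≡.refl (∑-⊛ x xs)) (∑-⟦⟧ b xs)

    guards : ∀ p q d {x y z z′} → z ≈ z′ → ⟦ p ⟧ (x ⊛ ⟦ q ∧ d ⟧ (y ⊛ z)) ≈ ⟦ q ⟧ (y ⊛ ⟦ p ∧ d ⟧ (x ⊛ z′))
    guards false false d     eq = refl
    guards false true  d     eq = sym (zeroʳ _)
    guards true  false d     eq = zeroʳ _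
    guards true  true  false eq = trans (zeroʳ _) (sym (zeroʳ _))
    guards true  true  true  eq = trans (⊛-congˡ (⊛-congˡ eq))
      (solve 3 (λ x y z → x :* (y :* z) := y :* (x :* z)) refl _ _ _)

    both-comm : ∀ P Q → both P Q ≗ both Q P
    both-comm P Q Z = ≡.trans (∧-assoc (ok Z) _ _)
      (≡.trans (cong (ok Z ∧_) (∧-comm (disjointᵇ P Z) (disjointᵇ Q Z))) (≡.sym (∧-assoc (ok Z) _ _)))

    exchanged : ∀ P Q → ⟦ ok P ⟧ (pathWeight P ⊛ inner P Q) ≈ ⟦ ok Q ⟧ (pathWeight Q ⊛ inner Q P)
    exchanged P Q rewrite disjointᵇ-sym Q P = guards (ok P) (ok Q) (disjointᵇ P Q) (pathSum-cong-≗ Fs (both-comm P Q))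

  pathSum-∷ : ∀ F Fs Gs → (∀ ok → pathSum ok Fs ≈ pathSum ok Gs) → ∀ ok → pathSum ok (F ∷ Fs) ≈ pathSum ok (F ∷ Gs)
  pathSum-∷ F Fs Gs eq ok = ∑-cong F (λ P → ⟦⟧-cong {ok P} ≡.refl (⊛-congˡ (eq _)))

  -- Brings any family to the front. It is proved for all `ok` because the test changes with each
  -- chosen path.
  pathSum-↭ : ∀ {Fs Gs} → Fs ↭ Gs → ∀ ok → pathSum ok Fs ≈ pathSum ok Gs
  pathSum-↭ Perm.refl              ok = refl
  pathSum-↭ (prep {Fs} {Gs} F p)   ok = pathSum-∷ F Fs Gs (pathSum-↭ p) ok
  pathSum-↭ (swap {Fs} {Gs} F G p) ok =
    trans (pathSum-∷ F (G ∷ Fs) (G ∷ Gs) (pathSum-∷ G Fs Gs (pathSum-↭ p)) ok) (pathSum-swap ok F G Gs)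
  pathSum-↭ (Perm.trans p q)       ok = trans (pathSum-↭ p ok) (pathSum-↭ q ok)

  -- Sums over non-intersecting tuples as sums over families.

  weight-∷ : ∀ P t → weight R w (P ∷ t) ≈ pathWeight P ⊛ weight R w t
  weight-∷ []            t = sym (⊛-identityˡ _)
  weight-∷ ((i , j) ∷ P) t = trans (⊛-congˡ (weight-∷ P t)) (sym (⊛-assoc _ _ _))

  weight-∷ʳ : ∀ t P → weight R w (t ++ [ P ]) ≈ weight R w t ⊛ pathWeight P
  weight-∷ʳ []      P = trans (weight-∷ P []) (solve 1 (λ x → x :* con 1 := con 1 :* x) refl _)
  weight-∷ʳ (Q ∷ t) P = begin
    weight R w (Q ∷ t ++ [ P ])                         ≈⟨ weight-∷ Q (t ++ [ P ]) ⟩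
    pathWeight Q ⊛ weight R w (t ++ [ P ])              ≈⟨ ⊛-congˡ (weight-∷ʳ t P) ⟩
    pathWeight Q ⊛ (weight R w t ⊛ pathWeight P)        ≈⟨ ⊛-assoc _ _ _ ⟨
    (pathWeight Q ⊛ weight R w t) ⊛ pathWeight P        ≈⟨ ⊛-congʳ (weight-∷ Q t) ⟨
    weight R w (Q ∷ t) ⊛ pathWeight P                   ∎

  disjointSum : List (List Path) → Carrier
  disjointSum = pathSum (λ _ → true)

  -- `tuples` extends at the end while `pathSum` consumes from the front. The induction therefore
  -- carries a mixed sum, a tuple followed by families `Fs` still to choose from, and turns the last
  -- coordinate into the first family.
  tuples-pathSum : ∀ f n Fs →
    ∑ (tuples f n) (λ t → ⟦ pairwiseDisjointᵇ t ⟧ (weight R w t ⊛ pathSum (λ Q → all (λ P → disjointᵇ P Q) t) Fs))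
      ≈ disjointSum (prepend f n Fs)
  tuples-pathSum f zero    Fs = trans (⊕-identityʳ _) (⊛-identityˡ _)
  tuples-pathSum f (suc n) Fs = begin
    ∑ (tuples f (suc n)) (term Fs)                                        ≈⟨ ∑-concatMap _ (tuples f n) ⟩
    ∑ (tuples f n) (λ t → ∑ (map (λ q → t ++ [ q ]) (f (suc n))) (term Fs)) ≈⟨ ∑-cong (tuples f n) extend ⟩
    ∑ (tuples f n) (term (f (suc n) ∷ Fs))                                ≈⟨ tuples-pathSum f n (f (suc n) ∷ Fs) ⟩
    disjointSum (prepend f n (f (suc n) ∷ Fs))                                      ∎
    where
    compatible : List Path → Path → Bool
    compatible t Q = all (λ P → disjointᵇ P Q) t

    term : List (List Path) → List Path → Carrier
    term Gs t = ⟦ pairwiseDisjointᵇ t ⟧ (weight R w t ⊛ pathSum (compatible t) Gs)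

    guards : ∀ p q {x y z} → ⟦ p ∧ q ⟧ ((x ⊛ y) ⊛ z) ≈ ⟦ p ⟧ (x ⊛ ⟦ q ⟧ (y ⊛ z))
    guards true  true  = ⊛-assoc _ _ _
    guards true  false = sym (zeroʳ _)
    guards false q     = refl

    extend : ∀ t → ∑ (map (λ q → t ++ [ q ]) (f (suc n))) (term Fs) ≈ term (f (suc n) ∷ Fs) t
    extend t = begin
      ∑ (map (λ q → t ++ [ q ]) (f (suc n))) (term Fs)   ≈⟨ ∑-map _ (f (suc n)) ⟩
      ∑ (f (suc n)) (λ q → term Fs (t ++ [ q ]))
        ≈⟨ ∑-cong (f (suc n)) (λ q → ⟦⟧-cong (pairwiseDisjointᵇ-∷ʳ t q)
             (⊛-cong (weight-∷ʳ t q) (pathSum-cong-≗ Fs (λ Q → all-∷ʳ (λ P → disjointᵇ P Q) t q)))) ⟩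
      ∑ (f (suc n)) (λ q → ⟦ pairwiseDisjointᵇ t ∧ compatible t q ⟧ ((weight R w t ⊛ pathWeight q) ⊛ _))
        ≈⟨ ∑-cong (f (suc n)) (λ q → guards (pairwiseDisjointᵇ t) (compatible t q)) ⟩
      ∑ (f (suc n)) (λ q → ⟦ pairwiseDisjointᵇ t ⟧ (weight R w t ⊛ _))
        ≈⟨ ∑-⟦⟧ (pairwiseDisjointᵇ t) (f (suc n)) ⟨
      ⟦ pairwiseDisjointᵇ t ⟧ ∑ (f (suc n)) (λ q → weight R w t ⊛ _)
        ≈⟨ ⟦⟧-cong {pairwiseDisjointᵇ t} ≡.refl (∑-⊛ (weight R w t) (f (suc n))) ⟨
      term (f (suc n) ∷ Fs) t ∎

  sumOver-nonIntersecting : ∀ f c → sumOver R w (nonIntersecting f c) ≈ disjointSum (prepend f c [])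
  sumOver-nonIntersecting f c = begin
    ∑ (filter (λ t → T? (pairwiseDisjointᵇ t)) (tuples f c)) (weight R w)   ≈⟨ ∑-filter pairwiseDisjointᵇ (tuples f c) ⟩
    ∑ (tuples f c) (λ t → ⟦ pairwiseDisjointᵇ t ⟧ weight R w t)
      ≈⟨ ∑-cong (tuples f c) (λ t → ⟦⟧-cong {pairwiseDisjointᵇ t} ≡.refl (sym (⊛-identityʳ _))) ⟩
    ∑ (tuples f c) (λ t → ⟦ pairwiseDisjointᵇ t ⟧ (weight R w t ⊛ 1#))      ≈⟨ tuples-pathSum f c [] ⟩
    disjointSum (prepend f c [])                                                     ∎

  -- Removing one column from a sum over disjoint paths.

  disjointSum-step-head : ∀ i j F Fs → All (All (Free (i , j))) Fs → disjointSum (map ((i , j) ∷_) F ∷ Fs) ≈ w i j ⊛ disjointSum (F ∷ Fs)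
  disjointSum-step-head i j F Fs free = begin
    disjointSum (map ((i , j) ∷_) F ∷ Fs)
      ≈⟨ ∑-map _ F ⟩
    ∑ F (λ P → (w i j ⊛ pathWeight P) ⊛ pathSum (disjointᵇ ((i , j) ∷ P)) Fs)
      -- No other path contains the cell, so removing it from `P` does not affect disjointness.
      ≈⟨ ∑-cong F (λ P → trans (⊛-assoc _ _ _) (⊛-congˡ (⊛-congˡ (pathSum-cong
           (All.map (All.map (λ {Q} Q-free → cong (λ b → not b ∧ disjointᵇ P Q) Q-free)) free))))) ⟩
    ∑ F (λ P → w i j ⊛ (pathWeight P ⊛ pathSum (disjointᵇ P) Fs))
      ≈⟨ ∑-⊛ (w i j) F ⟨
    w i j ⊛ disjointSum (F ∷ Fs) ∎

  disjointSum-step : ∀ i j F G pre post → All (All (Free (i , j))) pre → All (All (Free (i , j))) post →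
    disjointSum (pre ++ map ((i , j) ∷_) (F ++ G) ∷ post) ≈ w i j ⊛ (disjointSum (pre ++ F ∷ post) ⊕ disjointSum (pre ++ G ∷ post))
  disjointSum-step i j F G pre post free-pre free-post = begin
    disjointSum (pre ++ map ((i , j) ∷_) (F ++ G) ∷ post)                    ≈⟨ to-front (map ((i , j) ∷_) (F ++ G)) ⟩
    disjointSum (map ((i , j) ∷_) (F ++ G) ∷ pre ++ post)                    ≈⟨ disjointSum-step-head i j (F ++ G) (pre ++ post) (++⁺ free-pre free-post) ⟩
    w i j ⊛ disjointSum ((F ++ G) ∷ pre ++ post)                             ≈⟨ ⊛-congˡ (∑-++ F G) ⟩
    w i j ⊛ (disjointSum (F ∷ pre ++ post) ⊕ disjointSum (G ∷ pre ++ post))            ≈⟨ ⊛-congˡ (⊕-cong (to-front F) (to-front G)) ⟨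
    w i j ⊛ (disjointSum (pre ++ F ∷ post) ⊕ disjointSum (pre ++ G ∷ post))            ∎
    where
    to-front : ∀ H → disjointSum (pre ++ H ∷ post) ≈ disjointSum (H ∷ pre ++ post)
    to-front H = pathSum-↭ (shift H pre post) _

  -- Excludes a path coming down into a row at which the next path enters.
  disjointSum-collision : ∀ u F G pre post → disjointSum (pre ++ map (u ∷_) F ∷ map (u ∷_) G ∷ post) ≈ 0#
  disjointSum-collision u F G pre post = begin
    disjointSum (pre ++ map (u ∷_) F ∷ map (u ∷_) G ∷ post)
      ≈⟨ pathSum-↭ (↭-trans (shift _ pre _) (prep _ (shift _ pre post))) _ ⟩
    disjointSum (map (u ∷_) F ∷ map (u ∷_) G ∷ pre ++ post)
      ≈⟨ ∑-map (u ∷_) F ⟩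
    ∑ F _
      ≈⟨ ∑-zero F (λ P → trans (⊛-congˡ (trans (∑-map (u ∷_) G)
           (∑-zero G (λ Q → ⟦⟧-cong (disjointᵇ-common-head u P Q) refl)))) (zeroʳ _)) ⟩
    0# ∎

  -- Excludes a path coming down past the last row.
  disjointSum-empty : ∀ pre post → disjointSum (pre ++ [] ∷ post) ≈ 0#
  disjointSum-empty pre post = pathSum-↭ (shift [] pre post) _

  -- Transfer through column j: columnT carries a path that comes down into the first
  -- of the remaining rows, columnF does not.
  columnF : ∀ {n c} → Vec ℕ n → ℕ → State n c → (State n c → Carrier) → Carrier
  columnT : ∀ {n c} → Vec ℕ n → ℕ → State n c → (State n (suc c) → Carrier) → Carrier
  columnF []       j []      k = k []
  columnF (r ∷ rs) j (out S) k = columnF rs j S (k ∘ out)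
  columnF (r ∷ rs) j (inn S) k = w r j ⊛ (columnF rs j S (k ∘ inn) ⊕ columnT rs j S (k ∘ out))
  columnT []       j []      k = 0#
  columnT (r ∷ rs) j (out S) k = w r j ⊛ (columnF rs j S (k ∘ inn) ⊕ columnT rs j S (k ∘ out))
  columnT (r ∷ rs) j (inn S) k = 0#

  columnF-cong : ∀ {n c} (rs : Vec ℕ n) j (S : State n c) {k k′} → (∀ S′ → k S′ ≈ k′ S′) → columnF rs j S k ≈ columnF rs j S k′
  columnT-cong : ∀ {n c} (rs : Vec ℕ n) j (S : State n c) {k k′} → (∀ S′ → k S′ ≈ k′ S′) → columnT rs j S k ≈ columnT rs j S k′
  columnF-cong []       j []      eq = eq []
  columnF-cong (r ∷ rs) j (out S) eq = columnF-cong rs j S (eq ∘ out)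
  columnF-cong (r ∷ rs) j (inn S) eq = ⊛-congˡ (⊕-cong (columnF-cong rs j S (eq ∘ inn)) (columnT-cong rs j S (eq ∘ out)))
  columnT-cong []       j []      eq = refl
  columnT-cong (r ∷ rs) j (out S) eq = ⊛-congˡ (⊕-cong (columnF-cong rs j S (eq ∘ inn)) (columnT-cong rs j S (eq ∘ out)))
  columnT-cong (r ∷ rs) j (inn S) eq = refl

  -- The combination is the one that `exchange` produces on a free row followed by an occupied one.
  columnF-linear : ∀ {n c} (rs : Vec ℕ n) j (S : State n c) t {p q} →
    columnF rs j S (λ S′ → p S′ ⊕ t ⊛ q S′) ≈ columnF rs j S p ⊕ t ⊛ columnF rs j S q
  columnT-linear : ∀ {n c} (rs : Vec ℕ n) j (S : State n c) t {p q} →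
    columnT rs j S (λ S′ → p S′ ⊕ t ⊛ q S′) ≈ columnT rs j S p ⊕ t ⊛ columnT rs j S q
  linear-step : ∀ {n c} (rs : Vec ℕ n) j (S : State n c) t v {p q : State n c → Carrier} {p′ q′ : State n (suc c) → Carrier} →
    v ⊛ (columnF rs j S (λ S′ → p S′ ⊕ t ⊛ q S′) ⊕ columnT rs j S (λ S′ → p′ S′ ⊕ t ⊛ q′ S′))
      ≈ v ⊛ (columnF rs j S p ⊕ columnT rs j S p′) ⊕ t ⊛ (v ⊛ (columnF rs j S q ⊕ columnT rs j S q′))
  columnF-linear []       j []      t = refl
  columnF-linear (r ∷ rs) j (out S) t = columnF-linear rs j S t
  columnF-linear (r ∷ rs) j (inn S) t = linear-step rs j S t (w r j)
  columnT-linear []       j []      t = sym (trans (⊕-identityˡ _) (zeroʳ t))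
  columnT-linear (r ∷ rs) j (out S) t = linear-step rs j S t (w r j)
  columnT-linear (r ∷ rs) j (inn S) t = sym (trans (⊕-identityˡ _) (zeroʳ t))
  linear-step rs j S t v = trans (⊛-congˡ (⊕-cong (columnF-linear rs j S t) (columnT-linear rs j S t)))
    (solve 6 (λ v t a b a′ b′ → v :* ((a :+ t :* b) :+ (a′ :+ t :* b′)) := v :* (a :+ a′) :+ t :* (v :* (b :+ b′)))
      refl v t _ _ _ _)

  -- Mutual induction along the rows. The families in `pre` have left column `j`; in
  -- `disjointSum-columnT` the path being carried stands between them and the paths still to enter.
  disjointSum-columnF : ∀ {n c} {rs : Vec ℕ n} → Unique rs → ∀ j h pre → (∀ r → All (All (Free (r , j))) pre) → (S : State n c) →
    disjointSum (pre ++ families rs S j (suc h)) ≈ columnF rs j S (λ S′ → disjointSum (pre ++ families rs S′ (suc j) h))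
  disjointSum-columnT : ∀ {n c} {rs : Vec ℕ n} → Unique rs → ∀ j h pre → (∀ r → All (All (Free (r , j))) pre) → (S : State n c) →
    disjointSum (pre ++ family rs c j (suc h) ∷ families rs S j (suc h)) ≈ columnT rs j S (λ S′ → disjointSum (pre ++ families rs S′ (suc j) h))
  -- A step to the right makes row `r` occupied in the next state, and the path joins `pre`; a
  -- vertical step leaves `r` free, and the path is carried into `rs`.
  disjointSum-column-step : ∀ {n c} {r} {rs : Vec ℕ n} → AllV (r ≢_) rs → Unique rs → ∀ j h pre →
    (∀ r → All (All (Free (r , j))) pre) → (S : State n c) →
    disjointSum (pre ++ family (r ∷ rs) c j (suc h) ∷ families rs S j (suc h))
      ≈ w r j ⊛ (columnF rs j S (λ S′ → disjointSum (pre ++ families (r ∷ rs) (inn S′) (suc j) h))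
                  ⊕ columnT rs j S (λ S′ → disjointSum (pre ++ families (r ∷ rs) (out S′) (suc j) h)))
  disjointSum-columnF []            j h pre free []      = refl
  disjointSum-columnF (r∉ ∷ unique) j h pre free (out S) = disjointSum-columnF unique j h pre free S
  disjointSum-columnF (r∉ ∷ unique) j h pre free (inn S) = disjointSum-column-step r∉ unique j h pre free S
  disjointSum-columnT []            j h pre free []      = disjointSum-empty pre []
  disjointSum-columnT (r∉ ∷ unique) j h pre free (out S) = disjointSum-column-step r∉ unique j h pre free S
  disjointSum-columnT {rs = r ∷ rs} (r∉ ∷ unique) j h pre free (inn S) = disjointSum-collision (r , j) _ _ pre (families rs S j (suc h))
  disjointSum-column-step {c = c} {r} {rs} r∉ unique j h pre free S = begin
    disjointSum (pre ++ family (r ∷ rs) c j (suc h) ∷ post)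
      ≈⟨ disjointSum-step r j right down pre post (free r) (families-free-row {j = j} r∉ S j (suc h)) ⟩
    w r j ⊛ (disjointSum (pre ++ right ∷ post) ⊕ disjointSum (pre ++ down ∷ post))
      ≈⟨ ⊛-congˡ (⊕-cong advanced (disjointSum-columnT unique j h pre free S)) ⟩
    w r j ⊛ (_ ⊕ _) ∎
    where
    post  = families rs S j (suc h)
    right = family (r ∷ rs) c (suc j) h
    down  = family rs c j (suc h)

    regroup : ∀ Fs → disjointSum ((pre ++ [ right ]) ++ Fs) ≈ disjointSum (pre ++ right ∷ Fs)
    regroup Fs = reflexive (cong disjointSum (++-assoc pre [ right ] Fs))

    advanced : disjointSum (pre ++ right ∷ post) ≈ columnF rs j S (λ S′ → disjointSum (pre ++ right ∷ families rs S′ (suc j) h))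
    advanced = begin
      disjointSum (pre ++ right ∷ post)            ≈⟨ regroup post ⟨
      disjointSum ((pre ++ [ right ]) ++ post)
        ≈⟨ disjointSum-columnF unique j h (pre ++ [ right ]) (λ s → ++⁺ (free s) (family-free-later s (r ∷ rs) c h ∷ [])) S ⟩
      columnF rs j S (λ S′ → disjointSum ((pre ++ [ right ]) ++ families rs S′ (suc j) h))
        ≈⟨ columnF-cong rs j S (λ S′ → regroup (families rs S′ (suc j) h)) ⟩
      columnF rs j S (λ S′ → disjointSum (pre ++ right ∷ families rs S′ (suc j) h)) ∎

  -- The indicator of the final state: after an occupied row all rows are occupied.
  atBottom : ∀ {n c} → State n c → Carrier
  atBottom []                = 1#
  atBottom (out S)           = atBottom S
  atBottom (inn {n} {c} S)   = ⟦ n ≡ᵇ c ⟧ atBottom S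

  transfer : ∀ {n c} → Vec ℕ n → ℕ → ℕ → State n c → Carrier
  transfer rs j zero    S = atBottom S
  transfer rs j (suc h) S = columnF rs j S (transfer rs (suc j) h)

  -- With no column left, a family holds the empty path exactly if its row is its target, which
  -- reproduces `atBottom`.
  disjointSum-families : ∀ {n c} {rs : Vec ℕ n} → Unique rs → ∀ j h (S : State n c) → disjointSum (families rs S j h) ≈ transfer rs j h S
  disjointSum-families []            j zero [] = refl
  disjointSum-families (r∉ ∷ unique) j zero (out S) = disjointSum-families unique j zero S
  disjointSum-families (r∉ ∷ unique) j zero (inn {n} {c} S) with n ≡ᵇ c
  ... | true  = trans (⊕-identityʳ _) (trans (⊛-identityˡ _) (disjointSum-families unique j zero S))
  ... | false = refl
  disjointSum-families {rs = rs} unique j (suc h) S = trans (disjointSum-columnF unique j h [] (λ _ → []) S)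
    (columnF-cong rs j S (disjointSum-families unique (suc j) h))

  -- The R-matrix and the two states that it fixes.

  -- The R-matrix for the rows at positions m and m + 1, counted from 0.
  exchange : ∀ {n c} → ℕ → Carrier → (State n c → Carrier) → State n c → Carrier
  exchange zero    t f []            = f []
  exchange zero    t f (inn S)       = f (inn S)
  exchange zero    t f (out [])      = f (out [])
  exchange zero    t f (out (out S)) = f (out (out S))
  exchange zero    t f (out (inn S)) = f (out (inn S)) ⊕ t ⊛ f (inn (out S))
  exchange (suc m) t f []            = f []
  exchange (suc m) t f (out S)       = exchange m t (f ∘ out) S
  exchange (suc m) t f (inn S)       = exchange m t (f ∘ inn) S

  exchange-zero : ∀ {n c} m t (S : State n c) → exchange m t (λ _ → 0#) S ≈ 0#
  exchange-zero zero    t []            = refl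
  exchange-zero zero    t (inn S)       = refl
  exchange-zero zero    t (out [])      = refl
  exchange-zero zero    t (out (out S)) = refl
  exchange-zero zero    t (out (inn S)) = trans (⊕-identityˡ _) (zeroʳ t)
  exchange-zero (suc m) t []            = refl
  exchange-zero (suc m) t (out S)       = exchange-zero m t S
  exchange-zero (suc m) t (inn S)       = exchange-zero m t S

  -- Moves the R-matrix past an earlier row, where the column operator weights the sum of a
  -- horizontal and a vertical continuation.
  exchange-linear : ∀ {n c} m t v {f g : State n c → Carrier} S →
    exchange m t (λ S → v ⊛ (f S ⊕ g S)) S ≈ v ⊛ (exchange m t f S ⊕ exchange m t g S)
  exchange-linear zero    t v []            = refl
  exchange-linear zero    t v (inn S)       = refl
  exchange-linear zero    t v (out [])      = refl
  exchange-linear zero    t v (out (out S)) = refl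
  exchange-linear zero    t v (out (inn S)) =
    solve 6 (λ v t a b a′ b′ → v :* (a :+ b) :+ t :* (v :* (a′ :+ b′)) := v :* ((a :+ t :* a′) :+ (b :+ t :* b′)))
      refl v t _ _ _ _
  exchange-linear (suc m) t v []            = refl
  exchange-linear (suc m) t v (out S)       = exchange-linear m t v S
  exchange-linear (suc m) t v (inn S)       = exchange-linear m t v S

  -- The R-matrix acts nontrivially only where a free row precedes an occupied one, which does not
  -- occur in this state.
  exchange-topRows : ∀ m t c a (f : State (c + a) c → Carrier) → exchange m t f (topRows c a) ≈ f (topRows c a)
  exchange-topRows zero    t zero    zero          f = refl
  exchange-topRows zero    t zero    (suc zero)    f = refl
  exchange-topRows zero    t zero    (suc (suc a)) f = refl
  exchange-topRows zero    t (suc c) a             f = refl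
  exchange-topRows (suc m) t zero    zero          f = refl
  exchange-topRows (suc m) t zero    (suc a)       f = exchange-topRows m t zero a (f ∘ out)
  exchange-topRows (suc m) t (suc c) a             f = exchange-topRows m t c a (f ∘ inn)

  -- The added term has an occupied row before a free one, and the indicator of the final state
  -- vanishes there.
  exchange-atBottom : ∀ {n c} m t (S : State n c) → exchange m t atBottom S ≈ atBottom S
  exchange-atBottom zero    t []            = refl
  exchange-atBottom zero    t (inn S)       = refl
  exchange-atBottom zero    t (out [])      = refl
  exchange-atBottom zero    t (out (out S)) = refl
  exchange-atBottom zero    t (out (inn {n} {c} S))
    rewrite ≢⇒≡ᵇ-false {suc n} {c} (>⇒≢ (s≤s (State⇒≤ S))) = trans (⊕-congˡ (zeroʳ t)) (⊕-identityʳ _)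
  exchange-atBottom (suc m) t []            = refl
  exchange-atBottom (suc m) t (out S)       = exchange-atBottom m t S
  exchange-atBottom (suc m) t (inn {n} {c} S) with n ≡ᵇ c
  ... | true  = exchange-atBottom m t S
  ... | false = exchange-zero m t S

  -- The Yang-Baxter relation and its passage through all columns.

  module _ {r s j : ℕ} {t : Carrier} (relation : w s j ≈ w r j ⊕ t ⊛ (w r j ⊛ w s j)) where

    private
      U = w r j
      V = w s j

    -- A path reaches the first of the two rows. The terms `p`, `q` and `z` stand for its leaving in
    -- the first row, leaving in the second, and going on past both. The extra `t ⊛ p` turns the
    -- factor `U` of `p` into `V`.
    exchange-upper : ∀ p q z → U ⊛ (p ⊕ V ⊛ ((q ⊕ t ⊛ p) ⊕ z)) ≈ V ⊛ (p ⊕ U ⊛ (q ⊕ z))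
    exchange-upper p q z = begin
      U ⊛ (p ⊕ V ⊛ ((q ⊕ t ⊛ p) ⊕ z))
        ≈⟨ solve 6 (λ u v t p q z → u :* (p :+ v :* ((q :+ t :* p) :+ z))
             := (u :+ t :* (u :* v)) :* p :+ v :* (u :* (q :+ z))) refl U V t p q z ⟩
      (U ⊕ t ⊛ (U ⊛ V)) ⊛ p ⊕ V ⊛ (U ⊛ (q ⊕ z))    ≈⟨ ⊕-congʳ (⊛-congʳ relation) ⟨
      V ⊛ p ⊕ V ⊛ (U ⊛ (q ⊕ z))                    ≈⟨ distribˡ _ _ _ ⟨
      V ⊛ (p ⊕ U ⊛ (q ⊕ z))                        ∎

    -- The same for a path entering at the second row; now the R-matrix also contributes on the
    -- right, with the path entering at the first.
    exchange-lower : ∀ p q z → V ⊛ ((q ⊕ t ⊛ p) ⊕ z) ≈ U ⊛ (q ⊕ z) ⊕ t ⊛ (V ⊛ (p ⊕ U ⊛ (q ⊕ z)))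
    exchange-lower p q z = begin
      V ⊛ ((q ⊕ t ⊛ p) ⊕ z)
        ≈⟨ solve 5 (λ v t p q z → v :* ((q :+ t :* p) :+ z) := v :* (q :+ z) :+ t :* (v :* p)) refl V t p q z ⟩
      V ⊛ (q ⊕ z) ⊕ t ⊛ (V ⊛ p)                        ≈⟨ ⊕-congʳ (⊛-congʳ relation) ⟩
      (U ⊕ t ⊛ (U ⊛ V)) ⊛ (q ⊕ z) ⊕ t ⊛ (V ⊛ p)
        ≈⟨ solve 6 (λ u v t p q z → (u :+ t :* (u :* v)) :* (q :+ z) :+ t :* (v :* p)
             := u :* (q :+ z) :+ t :* (v :* (p :+ u :* (q :+ z)))) refl U V t p q z ⟩
      U ⊛ (q ⊕ z) ⊕ t ⊛ (V ⊛ (p ⊕ U ⊛ (q ⊕ z)))        ∎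

    -- With a path reaching each of the two rows, the first cannot come down into the second, and
    -- only the order of the weights changes.
    both-rows : ∀ z → U ⊛ (V ⊛ z ⊕ 0#) ≈ V ⊛ (U ⊛ z ⊕ 0#)
    both-rows z = solve 3 (λ u v z → u :* (v :* z :+ con 0) := v :* (u :* z :+ con 0)) refl U V z

    -- The Yang–Baxter relation: the R-matrix does not depend on the column, so it can be
    -- moved through all of them.
    columnF-exchange : ∀ {n c m} {rs rs′ : Vec ℕ n} → AdjacentSwap m r s rs rs′ → (f : State n c → Carrier) → ∀ S →
      columnF rs j S (exchange m t f) ≈ exchange m t (λ S → columnF rs′ j S f) S
    columnT-exchange : ∀ {n c m} {rs rs′ : Vec ℕ n} → AdjacentSwap m r s rs rs′ → (f : State n (suc c) → Carrier) → ∀ S →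
      columnT rs j S (exchange m t f) ≈ exchange m t (λ S → columnT rs′ j S f) S
    columnF-exchange here f (out (out S)) = refl
    columnF-exchange (here {rs = rs}) f (out (inn S)) =
      trans (⊛-congˡ (⊕-congʳ (columnF-linear rs j S t))) (exchange-lower _ _ _)
    columnF-exchange (here {rs = rs}) f (inn (out S)) =
      trans (⊛-congˡ (⊕-congˡ (⊛-congˡ (⊕-congʳ (columnF-linear rs j S t))))) (exchange-upper _ _ _)
    columnF-exchange here f (inn (inn S)) = both-rows _
    columnF-exchange (there sw) f (out S) = columnF-exchange sw (f ∘ out) S
    columnF-exchange {m = suc m} (there {q = q} sw) f (inn S) = trans
      (⊛-congˡ (⊕-cong (columnF-exchange sw (f ∘ inn) S) (columnT-exchange sw (f ∘ out) S)))
      (sym (exchange-linear m t (w q j) S))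
    columnT-exchange (here {rs = rs}) f (out (out S)) =
      trans (⊛-congˡ (⊕-congˡ (⊛-congˡ (⊕-congʳ (columnF-linear rs j S t))))) (exchange-upper _ _ _)
    -- The term added on the right has a carried path coming down into an occupied row, so it
    -- vanishes.
    columnT-exchange here f (out (inn S)) =
      trans (both-rows _) (sym (trans (⊕-congˡ (zeroʳ t)) (⊕-identityʳ _)))
    columnT-exchange here f (inn S) = refl
    columnT-exchange {m = suc m} (there {q = q} sw) f (out S) = trans
      (⊛-congˡ (⊕-cong (columnF-exchange sw (f ∘ inn) S) (columnT-exchange sw (f ∘ out) S)))
      (sym (exchange-linear m t (w q j) S))
    columnT-exchange {m = suc m} (there sw) f (inn S) = sym (exchange-zero m t S)

  -- The R-matrix is inserted at the final state, which it fixes, and moved through the columns from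
  -- last to first; `t` must be the same in all of them.
  transfer-exchange : ∀ {n c m r s} {rs rs′ : Vec ℕ n} t → AdjacentSwap m r s rs rs′ → ∀ j h →
    (∀ l → j ≤ l → l < j + h → w s l ≈ w r l ⊕ t ⊛ (w r l ⊛ w s l)) → (S : State n c) →
    transfer rs j h S ≈ exchange m t (transfer rs′ j h) S
  transfer-exchange {m = m} t sw j zero relation S = sym (exchange-atBottom m t S)
  transfer-exchange {rs = rs} t sw j (suc h) relation S = trans
    (columnF-cong rs j S (transfer-exchange t sw (suc j) h
      (λ l j<l l< → relation l (<⇒≤ j<l) (subst (l <_) (≡.sym (+-suc j h)) l<))))
    (columnF-exchange (relation j ≤-refl (subst (j <_) (≡.sym (+-suc j h)) (s≤s (m≤m+n j h)))) sw _ S)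

  -- Invariance under reordering the rows, and the two sums.

  module _ (a b c : ℕ) (x y : ℕ → Carrier)
    (inverse : ∀ i j → 1 ≤ i → i ≤ a + c → 1 ≤ j → j ≤ b + c →
      CommutativeRing._-_ R (x i) (y j) ⊛ w i j ≈ 1#) where

    open CommutativeRing R using (_-_)

    -- Partial fractions: from (x_r - y_j) = (x_r - x_s) + (x_s - y_j), multiplied by both inverses.
    -- The coefficient x_r - x_s is independent of `j`.
    weight-relation : ∀ {r s j} → InRange (a + c) r → InRange (a + c) s → 1 ≤ j → j ≤ b + c →
      w s j ≈ w r j ⊕ (x r - x s) ⊛ (w r j ⊛ w s j)
    weight-relation {r} {s} {j} (1≤r , r≤) (1≤s , s≤) 1≤j j≤ = begin
      V                                                  ≈⟨ ⊛-identityˡ V ⟨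
      1# ⊛ V                                             ≈⟨ ⊛-congʳ (inverse r j 1≤r r≤ 1≤j j≤) ⟨
      ((x r - y j) ⊛ U) ⊛ V                              ≈⟨ ⊛-congʳ (⊛-congʳ split) ⟩
      (((x r - x s) ⊕ (x s - y j)) ⊛ U) ⊛ V
        ≈⟨ solve 4 (λ d e u v → ((d :+ e) :* u) :* v := u :* (e :* v) :+ d :* (u :* v)) refl _ _ U V ⟩
      U ⊛ ((x s - y j) ⊛ V) ⊕ (x r - x s) ⊛ (U ⊛ V)      ≈⟨ ⊕-congʳ (⊛-congˡ (inverse s j 1≤s s≤ 1≤j j≤)) ⟩
      U ⊛ 1# ⊕ (x r - x s) ⊛ (U ⊛ V)                     ≈⟨ ⊕-congʳ (⊛-identityʳ U) ⟩
      U ⊕ (x r - x s) ⊛ (U ⊛ V)                          ∎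
      where
      U = w r j
      V = w s j

      split : x r - y j ≈ (x r - x s) ⊕ (x s - y j)
      split = begin
        x r - y j                        ≈⟨ ⊕-congʳ (⊕-identityʳ (x r)) ⟨
        (x r ⊕ 0#) - y j                 ≈⟨ ⊕-congʳ (⊕-congˡ (CommutativeRing.-‿inverseˡ R (x s))) ⟨
        (x r ⊕ (0-x ⊕ x s)) - y j        ≈⟨ solve 4 (λ p q q′ z → (p :+ (q′ :+ q)) :+ z := (p :+ q′) :+ (q :+ z)) refl (x r) (x s) 0-x _ ⟩
        (x r - x s) ⊕ (x s - y j)        ∎
        where 0-x = CommutativeRing.-_ R (x s)

    transfer-rearrange : ∀ {rs rs′ : Vec ℕ (c + a)} → Star (Rearrange (a + c)) rs rs′ →
      transfer rs 1 (b + c) (topRows c a) ≈ transfer rs′ 1 (b + c) (topRows c a)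
    transfer-rearrange ε = refl
    transfer-rearrange (step {m} {r} {s} r∈ s∈ sw ◅ rest) = trans
      (transfer-exchange (x r - x s) sw 1 (b + c) (λ { l 1≤l (s≤s l≤) → weight-relation r∈ s∈ 1≤l l≤ }) (topRows c a))
      -- Having passed all columns, the R-matrix disappears at the initial state.
      (trans (exchange-topRows m _ c a _) (transfer-rearrange rest))

    LHS≈RHS : ∀ {h} → suc h ≡ b + c → LHS R a b c w ≈ RHS R a b c w
    LHS≈RHS {h} eq = begin
      LHS R a b c w                                           ≈⟨ sumOver-nonIntersecting (pathsΓ a b c) c ⟩
      -- The paths γ are listed from the bottom of the grid upwards, to match the decreasing row
      -- order.
      disjointSum (prepend (pathsΓ a b c) c [])                         ≈⟨ pathSum-↭ (prepend-↭ (pathsΓ a b c) c []) _ ⟩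
      disjointSum (descending (pathsΓ a b c) c ++ [])
        ≡⟨ cong disjointSum (≡.trans (++-identityʳ _) (≡.sym (families-decreasing a b c h eq c))) ⟩
      disjointSum (families decreasing (topRows c a) 1 (b + c))         ≈⟨ disjointSum-families (decreasing-unique (c + a)) 1 (b + c) _ ⟩
      transfer decreasing 1 (b + c) (topRows c a)
        ≈⟨ transfer-rearrange (increasing⇝decreasing (a + c) (c + a) (≤-reflexive (+-comm c a))) ⟨
      transfer increasing 1 (b + c) (topRows c a)             ≈⟨ disjointSum-families (increasing-unique 1 (c + a)) 1 (b + c) _ ⟨
      disjointSum (families increasing (topRows c a) 1 (b + c))
        ≡⟨ cong disjointSum (≡.trans (families-increasing a b c 1 h eq c)
             (≡.sym (≡.trans (prepend-segment (pathsΘ a b c) c 0) (cong (segment (pathsΘ a b c) 1) (+-identityʳ c))))) ⟩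
      disjointSum (prepend (pathsΘ a b c) c [])                         ≈⟨ sumOver-nonIntersecting (pathsΘ a b c) c ⟨
      RHS R a b c w                                           ∎
      where
      increasing decreasing : Vec ℕ (c + a)
      increasing = iterate suc 1 (c + a)
      decreasing = iterate (_∸ 1) (c + a) (c + a)

theorem3p10 : {ℓ₁ ℓ₂ : Level} (R : CommutativeRing ℓ₁ ℓ₂) (a b c : ℕ) → 1 ≤ c →
    (x y : ℕ → CommutativeRing.Carrier R) (w : ℕ → ℕ → CommutativeRing.Carrier R) →
    (∀ i j → 1 ≤ i → i ≤ a + c → 1 ≤ j → j ≤ b + c →
    CommutativeRing._≈_ R (CommutativeRing._*_ R (CommutativeRing._-_ R (x i) (y j)) (w i j)) (CommutativeRing.1# R)) →
    CommutativeRing._≈_ R (LHS R a b c w) (RHS R a b c w)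
-- Positivity of the number of paths ensures that there is at least one column.
theorem3p10 R a b (suc c) (s≤s z≤n) x y w inverse = LHS≈RHS R w a b (suc c) x y inverse (≡.sym (+-suc b c))
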